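{- Let $G$ be a graph that is nonempty (i.e. has at least one edge), let $r\ge 0$ be an integer, and let $t=\chi(\mathcal M^r(G))$. Suppose that $t$ is odd and that the length of the shortest odd cycle of $G$ (its odd girth, taken to be $\infty$ if $G$ has no odd cycle) is strictly greater than $t$. Then $\alpha^\circ(\mathcal M^r(G))<t$.
   Context: All graphs are finite, undirected and simple; $\chi$ denotes the chromatic number. The length of a cycle is its number of vertices (equivalently edges). Circular altitude. A circular ordering $\sigma$ of $V(G)$ is a one-to-one assignment of $V(G)$ to the vertices of a directed cycle. A cycle $u_1,u_2,\ldots,u_n$ of $G$ is monotonic for $\sigma$ if $u_1,\ldots,u_n,u_1$ appear in this circular order in $\sigma$. Edges of $G$ are regarded as monotonic cycles of length two. The circular altitude $\alpha^\circ(G)$ of a graph $G$ with at least one edge is the largest $k$ such that every circular ordering of $V(G)$ contains a monotonic cycle of length at least $k$. Mycielskian. Given a graph $G$, the Mycielskian $\mathcal M(G)$ has vertex set $\{w\}\cup\{a^u \mid a\in V(G)\}\cup\{a^v\mid a\in V(G)\}$ (all these vertices distinct; $u,v$ are formal labels). Its edges are: $a^v b^v$, $a^u b^v$ and $b^u a^v$ for every edge $ab$ of $G$, and $w a^u$ for every $a\in V(G)$; there are no other edges. $\mathcal M^0(G)=G$ and $\mathcal M^{d}(G)=\mathcal M(\mathcal M^{d-1}(G))$ for $d\ge 1$. -}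

module Defs where

open import Data.Empty using (⊥)
open import Data.Fin as Fin using (Fin; zero; suc; inject₁; fromℕ)
open import Data.Fin.Properties as Fin using (any?; all?; inj⇒≟; injective⇒≤; 1↔⊤; +↔⊎)
open import Data.Nat using (ℕ; zero; suc; _+_; _≤_; _<_; z≤n; s≤s; _≤?_; parity)
open import Data.Nat.Properties as ℕ using (≤-refl; ≤-trans; ≮⇒≥; n≮0; anyUpTo?)
open import Data.Parity.Base using (1ℙ)
open import Data.Parity.Properties using () renaming (_≟_ to _≟ₚ_)
open import Data.Product using (∃; ∃₂; _×_; _,_; proj₁; proj₂)
open import Data.Sum using (_⊎_; inj₁; inj₂)
open import Data.Sum.Function.Propositional using (_⊎-↔_)
open import Data.Unit using (⊤; tt)
open import Data.Vec.Functional using ([]; _∷_)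
open import Function using (_∘_; _↔_; _⤖_; Injective; Surjective; Bijective; Inverse; Bijection; mk⤖; mk↔ₛ′)
open import Function.Properties.Inverse using (↔⇒↣; ↔⇒⤖; ↔-sym; ↔-trans)
open import Relation.Binary using (Rel; Symmetric; Irreflexive; Decidable; DecidableEquality)
open import Relation.Binary.PropositionalEquality using (_≡_; _≢_; _≗_; refl; sym; trans; cong; subst; subst₂)
open import Relation.Binary.Construct.Add.Supremum.Strict _<_ using (_<⁺_) public
open import Relation.Nullary using (¬_; Dec; yes; no; ¬?; contradiction)
open import Relation.Nullary.Construct.Add.Supremum using (_⁺; ⊤⁺; [_]) public
open import Relation.Nullary.Decidable using (map′; _×-dec_; _⊎-dec_; _→-dec_; decidable-stable)
open import Level using (0ℓ)
import Relation.Unary as U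

record Graph : Set₁ where
  field
    Vertex      : Set
    order       : ℕ
    enumeration : Vertex ↔ Fin order
    Adj         : Rel Vertex 0ℓ
    adj?        : Decidable Adj
    adj-sym     : Symmetric Adj
    adj-irrefl  : Irreflexive _≡_ Adj

open Graph

HasEdge : Graph → Set
HasEdge G = ∃₂ λ a b → Adj G a b

Odd : ℕ → Set
Odd n = parity n ≡ 1ℙ

CyclicallyAdjacent : (G : Graph) {ℓ : ℕ} → (Fin ℓ → Vertex G) → Set
CyclicallyAdjacent G {zero}  c = ⊥
CyclicallyAdjacent G {suc n} c =
  (∀ (i : Fin n) → Adj G (c (inject₁ i)) (c (suc i))) × Adj G (c (fromℕ n)) (c zero)

IsCycle : (G : Graph) {ℓ : ℕ} → (Fin ℓ → Vertex G) → Set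
IsCycle G {ℓ} c = 3 ≤ ℓ × Injective _≡_ _≡_ c × CyclicallyAdjacent G c

-- For ℓ = 2 this says that c lists the two ends of an edge.
IsCycleOrEdge : (G : Graph) {ℓ : ℕ} → (Fin ℓ → Vertex G) → Set
IsCycleOrEdge G {ℓ} c = 2 ≤ ℓ × Injective _≡_ _≡_ c × CyclicallyAdjacent G c

IsColouring : (G : Graph) {k : ℕ} → (Vertex G → Fin k) → Set
IsColouring G f = ∀ a b → Adj G a b → f a ≢ f b

Colourable : Graph → ℕ → Set
Colourable G k = ∃ λ (f : Vertex G → Fin k) → IsColouring G f

IsLeast : (ℕ → Set) → ℕ → Set
IsLeast P m = P m × (∀ k → P k → m ≤ k)

IsGreatest : (ℕ → Set) → ℕ → Set
IsGreatest P m = P m × (∀ k → P k → k ≤ m)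

IsChromaticNumber : Graph → ℕ → Set
IsChromaticNumber G = IsLeast (Colourable G)

HasOddCycle : Graph → ℕ → Set
HasOddCycle G ℓ = Odd ℓ × ∃ λ (c : Fin ℓ → Vertex G) → IsCycle G c

IsOddGirth : Graph → ℕ ⁺ → Set
IsOddGirth G ⊤⁺    = ∀ ℓ → ¬ HasOddCycle G ℓ
IsOddGirth G [ g ] = IsLeast (HasOddCycle G) g

-- Fin (order G) stands for the directed cycle 0 → 1 → ⋯ → order G - 1 → 0.
CircularOrdering : Graph → Set
CircularOrdering G = Vertex G ⤖ Fin (order G)

-- Following the directed cycle on Fin n from x, one meets y strictly before z,
-- and z strictly before returning to x.
InCircularOrder : {n : ℕ} → Fin n → Fin n → Fin n → Set
InCircularOrder x y z =
  (x Fin.< y × y Fin.< z) ⊎ (y Fin.< z × z Fin.< x) ⊎ (z Fin.< x × x Fin.< y)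

IsMonotonicCycle : (G : Graph) → (Vertex G → Fin (order G)) →
                   {ℓ : ℕ} → (Fin ℓ → Vertex G) → Set
IsMonotonicCycle G σ c =
  IsCycleOrEdge G c ×
  (∀ i j k → i Fin.< j → j Fin.< k → InCircularOrder (σ (c i)) (σ (c j)) (σ (c k)))

HasMonotonicCycle≥ : (G : Graph) → (Vertex G → Fin (order G)) → ℕ → Set
HasMonotonicCycle≥ G σ k =
  ∃ λ ℓ → k ≤ ℓ × ∃ λ (c : Fin ℓ → Vertex G) → IsMonotonicCycle G σ c

IsCircularAltitude : Graph → ℕ → Set
IsCircularAltitude G =
  IsGreatest (λ k → (σ : CircularOrdering G) → HasMonotonicCycle≥ G (Bijection.to σ) k)

data MycielskiVertex (V : Set) : Set where
  w  : MycielskiVertex V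
  _ᵘ : V → MycielskiVertex V
  _ᵛ : V → MycielskiVertex V

data MycielskiAdj {V : Set} (E : Rel V 0ℓ) : Rel (MycielskiVertex V) 0ℓ where
  vv : ∀ {a b} → E a b → MycielskiAdj E (a ᵛ) (b ᵛ)
  uv : ∀ {a b} → E a b → MycielskiAdj E (a ᵘ) (b ᵛ)
  vu : ∀ {a b} → E a b → MycielskiAdj E (a ᵛ) (b ᵘ)
  wu : ∀ {a} → MycielskiAdj E w (a ᵘ)
  uw : ∀ {a} → MycielskiAdj E (a ᵘ) w

𝓜 : Graph → Graph
𝓜 G = record
  { Vertex      = MycielskiVertex (Vertex G)
  ; order       = 1 + (order G + order G)
  ; enumeration = ↔-trans asSum (↔-trans
                    (↔-sym 1↔⊤ ⊎-↔ ↔-trans (enumeration G ⊎-↔ enumeration G) (↔-sym +↔⊎))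
                    (↔-sym +↔⊎))
  ; Adj         = MycielskiAdj (Adj G)
  ; adj?        = dec
  ; adj-sym     = λ { (vv e) → vv (adj-sym G e) ; (uv e) → vu (adj-sym G e)
                    ; (vu e) → uv (adj-sym G e) ; wu → uw ; uw → wu }
  ; adj-irrefl  = λ { refl (vv e) → adj-irrefl G refl e }
  }
  where
  asSum : MycielskiVertex (Vertex G) ↔ (⊤ ⊎ (Vertex G ⊎ Vertex G))
  asSum = mk↔ₛ′
    (λ { w → inj₁ tt ; (a ᵘ) → inj₂ (inj₁ a) ; (a ᵛ) → inj₂ (inj₂ a) })
    (λ { (inj₁ tt) → w ; (inj₂ (inj₁ a)) → a ᵘ ; (inj₂ (inj₂ a)) → a ᵛ })
    (λ { (inj₁ tt) → refl ; (inj₂ (inj₁ a)) → refl ; (inj₂ (inj₂ a)) → refl })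
    (λ { w → refl ; (a ᵘ) → refl ; (a ᵛ) → refl })

  dec : Decidable (MycielskiAdj (Adj G))
  dec w     w     = no λ ()
  dec w     (b ᵘ) = yes wu
  dec w     (b ᵛ) = no λ ()
  dec (a ᵘ) w     = yes uw
  dec (a ᵘ) (b ᵘ) = no λ ()
  dec (a ᵘ) (b ᵛ) = map′ uv (λ { (uv e) → e }) (adj? G a b)
  dec (a ᵛ) w     = no λ ()
  dec (a ᵛ) (b ᵘ) = map′ vu (λ { (vu e) → e }) (adj? G a b)
  dec (a ᵛ) (b ᵛ) = map′ vv (λ { (vv e) → e }) (adj? G a b)

𝓜^ : ℕ → Graph → Graph
𝓜^ zero    G = G
𝓜^ (suc d) G = 𝓜 (𝓜^ d G)

𝓜^-hasEdge : ∀ {G} d → HasEdge G → HasEdge (𝓜^ d G)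
𝓜^-hasEdge zero    e = e
𝓜^-hasEdge (suc d) e = let a , b , ab = 𝓜^-hasEdge d e in a ᵛ , b ᵛ , vv ab

private
  least : {P : ℕ → Set} → U.Decidable P → ∀ n → P n → ∃ (IsLeast P)
  least {P} P? n Pn = go n (λ k k<0 _ → n≮0 k<0) Pn
    where
    go : ∀ d {m} → (∀ k → k < m → ¬ P k) → P (m + d) → ∃ (IsLeast P)
    go zero {m} none p =
      m , subst P (ℕ.+-identityʳ m) p , λ k Pk → ≮⇒≥ λ k<m → none k k<m Pk
    go (suc d) {m} none p with P? m
    ... | yes Pm = m , Pm , λ k Pk → ≮⇒≥ λ k<m → none k k<m Pk
    ... | no ¬Pm = go d {suc m} none′ (subst P (ℕ.+-suc m d) p)
      where
      none′ : ∀ k → k < suc m → ¬ P k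
      none′ k (s≤s k≤m) Pk with ℕ.m≤n⇒m<n∨m≡n k≤m
      ... | inj₁ k<m  = none k k<m Pk
      ... | inj₂ refl = ¬Pm Pk

  greatest : {P : ℕ → Set} → U.Decidable P → ∀ {b} → P b → ∀ n → (∀ k → P k → k ≤ n) → ∃ (IsGreatest P)
  greatest P? {b} Pb zero bound with z≤n ← bound b Pb = zero , Pb , bound
  greatest {P} P? Pb (suc n) bound with P? (suc n)
  ... | yes p = suc n , p , bound
  ... | no ¬p = greatest P? Pb n bound′
    where
    bound′ : ∀ k → P k → k ≤ n
    bound′ k Pk with ℕ.m≤n⇒m<n∨m≡n (bound k Pk)
    ... | inj₁ (s≤s k≤n) = k≤n
    ... | inj₂ refl      = contradiction Pk ¬p

  Extensional : {A B : Set} → ((A → B) → Set) → Set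
  Extensional P = ∀ {f g} → f ≗ g → P f → P g

  anyFin→? : ∀ {m n} {P : (Fin m → Fin n) → Set} → Extensional P → U.Decidable P → Dec (∃ P)
  anyFin→? {zero}  ext P? = map′ (λ p → [] , p) (λ (_ , p) → ext (λ ()) p) (P? [])
  anyFin→? {suc m} ext P? =
    map′ (λ (x , f , p) → (x ∷ f) , p)
         (λ (f , p) → f zero , f ∘ suc , ext (λ { zero → refl ; (suc i) → refl }) p)
         (any? λ x → anyFin→? (λ eq → ext λ { zero → refl ; (suc i) → eq i }) λ f → P? (x ∷ f))

  any→? : ∀ {A B : Set} {m n} → A ↔ Fin m → B ↔ Fin n → {P : (A → B) → Set} →
          Extensional P → U.Decidable P → Dec (∃ P)
  any→? A↔ B↔ ext P? =
    map′ (λ (f , p) → _ , p)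
         (λ (f , p) → B.to ∘ f ∘ A.from ,
           ext (λ a → sym (trans (B.strictlyInverseʳ _) (cong f (A.strictlyInverseʳ a)))) p)
         (anyFin→? (λ eq → ext λ a → cong B.from (eq (A.to a)))
                   (λ f → P? (B.from ∘ f ∘ A.to)))
    where
    module A = Inverse A↔
    module B = Inverse B↔

  Fin↔ : ∀ {n} → Fin n ↔ Fin n
  Fin↔ = mk↔ₛ′ (λ i → i) (λ i → i) (λ _ → refl) (λ _ → refl)

  module _ {A : Set} {m : ℕ} (A↔ : A ↔ Fin m) where
    open Inverse A↔

    all∈? : {P : A → Set} → U.Decidable P → Dec (∀ a → P a)
    all∈? {P} P? = map′ (λ f a → subst P (strictlyInverseʳ a) (f (to a))) (λ f i → f (from i))
                        (all? (P? ∘ from))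

    any∈? : {P : A → Set} → U.Decidable P → Dec (∃ P)
    any∈? {P} P? = map′ (λ (i , p) → from i , p)
                        (λ (a , p) → to a , subst P (sym (strictlyInverseʳ a)) p)
                        (any? (P? ∘ from))

    ≟∈ : DecidableEquality A
    ≟∈ = inj⇒≟ (↔⇒↣ A↔)

    injective? : ∀ {B : Set} → DecidableEquality B → (f : A → B) → Dec (Injective _≡_ _≡_ f)
    injective? _≟_ f = map′ (λ h {x} {y} → h x y) (λ h x y → h)
      (all∈? λ x → all∈? λ y → (f x ≟ f y) →-dec ≟∈ x y)

  injective-ext : ∀ {A B : Set} → Extensional {A} {B} (Injective _≡_ _≡_)
  injective-ext eq inj h = inj (trans (eq _) (trans h (sym (eq _))))

  surjective-ext : ∀ {A B : Set} → Extensional {A} {B} (Surjective _≡_ _≡_)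
  surjective-ext eq sur y = let x , h = sur y in x , λ z≡x → trans (sym (eq _)) (h z≡x)

  module _ (G : Graph) where

    cyclicallyAdjacent? : ∀ {ℓ} → U.Decidable (CyclicallyAdjacent G {ℓ})
    cyclicallyAdjacent? {zero}  c = no λ ()
    cyclicallyAdjacent? {suc ℓ} c = all? (λ _ → adj? G _ _) ×-dec adj? G _ _

    cyclicallyAdjacent-ext : ∀ {ℓ} → Extensional (CyclicallyAdjacent G {ℓ})
    cyclicallyAdjacent-ext {suc ℓ} eq (h , l) =
      (λ i → subst₂ (Adj G) (eq _) (eq _) (h i)) , subst₂ (Adj G) (eq _) (eq _) l

    module _ (b : ℕ) {ℓ : ℕ} where
      cycle? : U.Decidable {A = Fin ℓ → Vertex G}
                 (λ c → b ≤ ℓ × Injective _≡_ _≡_ c × CyclicallyAdjacent G c)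
      cycle? c = (b ≤? ℓ) ×-dec injective? Fin↔ (≟∈ (enumeration G)) c ×-dec cyclicallyAdjacent? c

      cycle-ext : Extensional {Fin ℓ} {Vertex G}
                    (λ c → b ≤ ℓ × Injective _≡_ _≡_ c × CyclicallyAdjacent G c)
      cycle-ext eq (p , inj , adj) = p , injective-ext eq inj , cyclicallyAdjacent-ext eq adj

    length≤order : ∀ {ℓ} (c : Fin ℓ → Vertex G) → Injective _≡_ _≡_ c → ℓ ≤ order G
    length≤order c inj = injective⇒≤ {f = Inverse.to (enumeration G) ∘ c}
      (inj ∘ Bijection.injective (↔⇒⤖ (enumeration G)))

    colourable? : U.Decidable (Colourable G)
    colourable? k = any→? (enumeration G) Fin↔
      (λ eq h a b e f≡ → h a b e (trans (eq a) (trans f≡ (sym (eq b)))))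
      (λ f → all∈? (enumeration G) λ a → all∈? (enumeration G) λ b →
               adj? G a b →-dec ¬? (f a Fin.≟ f b))

    hasOddCycle? : U.Decidable (HasOddCycle G)
    hasOddCycle? ℓ = (parity ℓ ≟ₚ 1ℙ) ×-dec any→? Fin↔ (enumeration G) (cycle-ext 3) (cycle? 3)

    inCircularOrder? : ∀ {n} (x y z : Fin n) → Dec (InCircularOrder x y z)
    inCircularOrder? x y z = (x Fin.<? y ×-dec y Fin.<? z) ⊎-dec
                             (y Fin.<? z ×-dec z Fin.<? x) ⊎-dec
                             (z Fin.<? x ×-dec x Fin.<? y)

    module _ (σ : Vertex G → Fin (order G)) where
      monotonicCycle? : ∀ {ℓ} → U.Decidable (IsMonotonicCycle G σ {ℓ})
      monotonicCycle? c = cycle? 2 c ×-dec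
        (all? λ i → all? λ j → all? λ k →
           (i Fin.<? j) →-dec (j Fin.<? k) →-dec inCircularOrder? _ _ _)

      monotonicCycle-ext : ∀ {ℓ} → Extensional (IsMonotonicCycle G σ {ℓ})
      monotonicCycle-ext {ℓ} {c} {d} eq (cyc , mono) = cycle-ext 2 eq cyc , λ i j k i<j j<k →
        subst (λ x → InCircularOrder x (σ (d j)) (σ (d k))) (cong σ (eq i))
          (subst₂ (InCircularOrder (σ (c i))) (cong σ (eq j)) (cong σ (eq k)) (mono i j k i<j j<k))

      hasMonotonicCycle≥? : U.Decidable (HasMonotonicCycle≥ G σ)
      hasMonotonicCycle≥? k =
        map′ (λ (ℓ , _ , h) → ℓ , h)
             (λ { (ℓ , k≤ℓ , c , h@((_ , inj , _) , _)) → ℓ , s≤s (length≤order c inj) , k≤ℓ , c , h })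
             (anyUpTo? (λ ℓ → (k ≤? ℓ) ×-dec any→? Fin↔ (enumeration G) monotonicCycle-ext monotonicCycle?)
                       (suc (order G)))

    hasMonotonicCycle≥-ext : ∀ {k} → Extensional (λ σ → HasMonotonicCycle≥ G σ k)
    hasMonotonicCycle≥-ext eq (ℓ , k≤ℓ , c , cyc , mono) = ℓ , k≤ℓ , c , cyc , λ i j k i<j j<k →
      subst (λ x → InCircularOrder x _ _) (eq (c i))
        (subst₂ (InCircularOrder _) (eq (c j)) (eq (c k)) (mono i j k i<j j<k))

    everyOrdering? : U.Decidable (λ k → (σ : CircularOrdering G) → HasMonotonicCycle≥ G (Bijection.to σ) k)
    everyOrdering? k =
      map′ (λ none σ → decidable-stable (hasMonotonicCycle≥? (Bijection.to σ) k)
                         λ ¬h → none (Bijection.to σ , Bijection.bijective σ , ¬h))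
           (λ { all (f , bij , ¬h) → ¬h (all (mk⤖ bij)) })
           (¬? (any→? (enumeration G) Fin↔ {Bad}
             (λ { eq ((inj , sur) , ¬h) → (injective-ext eq inj , surjective-ext eq sur) ,
                                          λ h → ¬h (hasMonotonicCycle≥-ext (sym ∘ eq) h) })
             (λ f → (injective? (enumeration G) Fin._≟_ f ×-dec surjective? f)
                    ×-dec ¬? (hasMonotonicCycle≥? f k))))
      where
      Bad : (Vertex G → Fin (order G)) → Set
      Bad f = Bijective _≡_ _≡_ f × ¬ HasMonotonicCycle≥ G f k

      surjective? : (f : Vertex G → Fin (order G)) → Dec (Surjective _≡_ _≡_ f)
      surjective? f = all? λ y →
        map′ (λ (x , h) → x , λ { refl → h }) (λ (x , h) → x , h refl)
             (any∈? (enumeration G) λ x → f x Fin.≟ y)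

-- Only the defining properties (the second projections) are exposed.
abstract
  chromaticNumber : (G : Graph) → ∃ (IsChromaticNumber G)
  chromaticNumber G = least (colourable? G) (order G)
    ( Inverse.to (enumeration G)
    , λ a b ab eq → adj-irrefl G (Bijection.injective (↔⇒⤖ (enumeration G)) eq) ab )

  oddGirthOf : (G : Graph) → ∃ (IsOddGirth G)
  oddGirthOf G with anyUpTo? (hasOddCycle? G) (suc (order G))
  ... | yes (ℓ , _ , h) = let g , l = least (hasOddCycle? G) ℓ h in [ g ] , l
  ... | no none = ⊤⁺ , λ { ℓ h@(_ , c , _ , inj , _) → none (ℓ , s≤s (length≤order G c inj) , h) }

  circularAltitude : (G : Graph) → HasEdge G → ∃ (IsCircularAltitude G)
  circularAltitude G (a , b , ab) = greatest (everyOrdering? G) {2} base (order G)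
    λ k h → let ℓ , k≤ℓ , c , (_ , inj , _) , _ = h (↔⇒⤖ (enumeration G))
            in ≤-trans k≤ℓ (length≤order G c inj)
    where
    edge : Fin 2 → Vertex G
    edge zero       = a
    edge (suc zero) = b

    edge-injective : Injective _≡_ _≡_ edge
    edge-injective {zero}     {zero}     _  = refl
    edge-injective {zero}     {suc zero} eq = contradiction ab (adj-irrefl G eq)
    edge-injective {suc zero} {zero}     eq = contradiction ab (adj-irrefl G (sym eq))
    edge-injective {suc zero} {suc zero} _  = refl

    base : (σ : CircularOrdering G) → HasMonotonicCycle≥ G (Bijection.to σ) 2
    base σ = 2 , ≤-refl , edge , (≤-refl , edge-injective , (λ { zero → ab }) , adj-sym G ab) ,
      λ { zero (suc zero) (suc zero) _ (s≤s ())
        ; zero (suc zero) zero _ ()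
        ; (suc zero) (suc zero) _ (s≤s ()) _
        ; zero zero _ () _ ; (suc zero) zero _ () _ }

χ : Graph → ℕ
χ G = proj₁ (chromaticNumber G)

oddGirth : Graph → ℕ ⁺
oddGirth G = proj₁ (oddGirthOf G)

-- Without an edge no largest k exists, so α° takes an edge as argument; by
-- the uniqueness of greatest elements its value does not depend on which.
α° : (G : Graph) → HasEdge G → ℕ
α° G e = proj₁ (circularAltitude G e)

{-# OPTIONS --safe #-}
module Submission where

-- A colouring of 𝓜(H) with k + 1 colours yields one of H with k colours, so G has a
-- colouring with the colours 0, …, s − 1, where s = t − r.  Extend it to 𝓜^i(G) by
-- giving aᵛ the colour of a, giving w the colour 1, and giving aᵘ the colour of a
-- unless that is 0 or 1, in which case aᵘ gets the new colour s + i − 1.  Order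
-- 𝓜^r(G) by colour classes 0, 1, …, t − 1.  A monotonic cycle meets each class at
-- most once, so one of length at least t is a closed walk x₀, …, x_{t−1} with x_p
-- of colour p.  Projecting it down one Mycielskian at a time, every position whose
-- colour has been lost keeps a colour in {0, 1}; these positions follow each other
-- up to position 0, so each vertex of colour 1 on the walk has a neighbour on it
-- of colour 0 or 1.  All neighbours of w have colour at least 2, hence the walk
-- never meets w and the projection reaches G.  There it is a closed walk of odd
-- length t, and it contains an odd cycle of length at most t.

open import Defs
open import Data.Bool using (T)
open import Data.Empty using (⊥-elim)
open import Data.Fin as Fin using (Fin; zero; suc; toℕ; fromℕ<; punchOut; combine)
open import Data.Fin.Properties as Fin
  using (toℕ<n; toℕ-injective; toℕ-fromℕ; toℕ-fromℕ<; toℕ-inject₁; any?; injective⇒≤; inj⇒≟;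
         punchOut-injective; combine-injectiveʳ; combine-monoˡ-<)
open import Data.Fin.Subset using (Subset; _∈_; ∣_∣)
open import Data.Fin.Subset.Properties using (p⊂q⇒∣p∣<∣q∣; ∣⊤∣≡n; ∈⊤)
open import Data.List using (allFin)
open import Data.List.Extrema.Nat using (argmin; f[argmin]≤f[xs])
open import Data.List.Membership.Propositional.Properties using (∈-allFin)
open import Data.List.Relation.Unary.All as All using ()
open import Data.Nat using (ℕ; zero; suc; _+_; _*_; _≤_; _<_; z≤n; s≤s; s≤s⁻¹; _<?_; parity)
open import Data.Nat.DivMod
  using (_%_; _/_; _mod_; m%n<n; n%n≡0; m<n⇒m%n≡m; [m+n]%n≡m%n; [m+kn]%n≡m%n; m≡m%n+[m/n]*n)
open import Data.Nat.Induction using (<-rec)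
open import Data.Nat.Properties
open import Data.Parity.Base as ℙ using (0ℙ; 1ℙ)
open import Data.Parity.Properties using (+-homo-+)
open import Data.Product using (∃; _×_; _,_; proj₁; proj₂)
open import Data.Sum using (_⊎_; inj₁; inj₂)
open import Data.Vec using (tabulate; lookup)
open import Data.Vec.Properties using (lookup∘tabulate; []=⇒lookup; lookup⇒[]=)
open import Function using (_∘_; Injective; Surjective; Inverse; Bijection; mk⤖)
open import Function.Properties.Inverse using (↔⇒↣; ↔⇒⤖)
open import Relation.Binary using (DecidableEquality; tri<; tri≈; tri>)
open import Relation.Binary.PropositionalEquality
open import Relation.Binary.Construct.Add.Supremum.Strict _<_ using ([_]; [_]<⊤⁺)
open import Relation.Nullary using (¬_; yes; no; does; contradiction)
open import Relation.Nullary.Decidable using (_×-dec_; dec-true)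

open Graph

infix 4 _≟ⱽ_

_≟ⱽ_ : {G : Graph} → DecidableEquality (Vertex G)
_≟ⱽ_ {G} = inj⇒≟ (↔⇒↣ (enumeration G))

ClosedWalk : (G : Graph) → ℕ → (ℕ → Vertex G) → Set
ClosedWalk G n x = (∀ k → k < n → Adj G (x k) (x (suc k))) × x n ≡ x 0

-- Odd closed walks contain odd cycles

module _ (G : Graph) where

  subwalk : ∀ {n x} i d → i + d ≤ n → ClosedWalk G n x → x i ≡ x (i + d) →
            ClosedWalk G d (λ k → x (i + k))
  subwalk {n} {x} i d i+d≤n (adj , _) eq =
    (λ k k<d → subst (λ m → Adj G (x (i + k)) (x m)) (sym (+-suc i k))
                 (adj (i + k) (<-≤-trans (+-monoʳ-< i k<d) i+d≤n))) ,
    trans (sym eq) (cong x (sym (+-identityʳ i)))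

  -- Cuts out the stretch of length `d` that starts at position `i`. At the seam both branches of
  -- `y` agree by the hypothesis on `x`, which is why `y-below` also covers `k = i`.
  shortcut : ∀ {x} i d e → ClosedWalk G (d + (i + e)) x → x i ≡ x (d + i) →
             ∃ (ClosedWalk G (i + e))
  shortcut {x} i d e (adj , closed) eq = y , y-adj , y-closed
    where
    y : ℕ → Vertex G
    y k with k <? i
    ... | yes _ = x k
    ... | no  _ = x (d + k)

    y-below : ∀ {k} → k ≤ i → y k ≡ x k
    y-below {k} k≤i with k <? i
    ... | yes _   = refl
    ... | no  k≮i with refl ← ≤-antisym k≤i (≮⇒≥ k≮i) = sym eq

    y-above : ∀ {k} → i ≤ k → y k ≡ x (d + k)
    y-above {k} i≤k with k <? i
    ... | yes k<i = contradiction i≤k (<⇒≱ k<i)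
    ... | no  _   = refl

    y-adj : ∀ k → k < i + e → Adj G (y k) (y (suc k))
    y-adj k k<i+e with k <? i
    ... | yes k<i = subst (Adj G (x k)) (sym (y-below k<i))
                      (adj k (<-≤-trans k<i (≤-trans (m≤m+n i e) (m≤n+m (i + e) d))))
    ... | no  k≮i = subst (Adj G (x (d + k)))
                      (trans (cong x (sym (+-suc d k))) (sym (y-above (m≤n⇒m≤1+n (≮⇒≥ k≮i)))))
                      (adj (d + k) (+-monoʳ-< d k<i+e))

    y-closed : y (i + e) ≡ y 0
    y-closed = trans (y-above (m≤m+n i e)) (trans closed (sym (y-below z≤n)))

  -- Length 1 would be a loop, and lengths 0 and 2 are even, so oddness leaves only lengths from 3
  -- on.
  injectiveClosedWalk⇒cycle : ∀ {n x} → Odd n → ClosedWalk G n x →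
    Injective _≡_ _≡_ (λ (i : Fin n) → x (toℕ i)) → HasOddCycle G n
  injectiveClosedWalk⇒cycle {suc zero} odd (adj , closed) inj =
    contradiction (adj 0 ≤-refl) (adj-irrefl G (sym closed))
  injectiveClosedWalk⇒cycle {suc (suc (suc n))} {x} odd (adj , closed) inj =
    odd , _ , s≤s (s≤s (s≤s z≤n)) , inj ,
    (λ i → subst (λ k → Adj G (x k) (x (suc (toℕ i)))) (sym (toℕ-inject₁ i))
             (adj (toℕ i) (m≤n⇒m≤1+n (toℕ<n i)))) ,
    subst₂ (λ k v → Adj G (x k) v) (sym (toℕ-fromℕ _)) closed (adj _ ≤-refl)

  -- Strong induction on the length: a repeated vertex splits the walk into two shorter closed
  -- walks, and exactly one of them has odd length. Without a repetition the walk is itself a cycle.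
  oddClosedWalk⇒oddCycle : ∀ n x → Odd n → ClosedWalk G n x → ∃ λ ℓ → ℓ ≤ n × HasOddCycle G ℓ
  oddClosedWalk⇒oddCycle = <-rec _ go
    where
    Goal : ℕ → Set
    Goal n = ∀ x → Odd n → ClosedWalk G n x → ∃ λ ℓ → ℓ ≤ n × HasOddCycle G ℓ

    shorter : ∀ {m n} → m < n → Goal m → ∀ x → Odd m → ClosedWalk G m x →
              ∃ λ ℓ → ℓ ≤ n × HasOddCycle G ℓ
    shorter m<n goal x odd walk =
      let ℓ , ℓ≤m , cycle = goal x odd walk in ℓ , ≤-trans ℓ≤m (<⇒≤ m<n) , cycle

    split : ∀ n i j → i < j → j < n → (∀ {m} → m < n → Goal m) →
            ∀ x → Odd n → ClosedWalk G n x → x i ≡ x j → ∃ λ ℓ → ℓ ≤ n × HasOddCycle G ℓ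
    split n i j i<j j<n rec x odd walk eq
      -- The part from `i` to `j` has length `suc d`; the rest of the walk has length `i + suc e`.
      with d , refl ← m≤n⇒∃[o]m+o≡n i<j
      with e , refl ← m≤n⇒∃[o]m+o≡n j<n
      = decide (parity (suc d)) refl
      where
      n′ : ℕ
      n′ = suc (suc i + d) + e

      n≡ : suc d + (i + suc e) ≡ n′
      n≡ = cong suc (begin
        d + (i + suc e)   ≡⟨ cong (d +_) (+-suc i e) ⟩
        d + suc (i + e)   ≡⟨ +-suc d (i + e) ⟩
        suc (d + (i + e)) ≡⟨ cong suc (sym (+-assoc d i e)) ⟩
        suc (d + i + e)   ≡⟨ cong (λ m → suc (m + e)) (+-comm d i) ⟩
        suc (i + d + e)   ∎)
        where open ≡-Reasoning

      decide : ∀ p → parity (suc d) ≡ p → ∃ λ ℓ → ℓ ≤ n′ × HasOddCycle G ℓ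
      decide 1ℙ d-odd = shorter lt (rec lt) _ d-odd
        (subwalk i (suc d) (≤-trans (≤-reflexive (+-suc i d)) (<⇒≤ j<n)) walk
          (trans eq (cong x (sym (+-suc i d)))))
        where
        lt : suc d < n′
        lt = subst (suc d <_) n≡ (m<m+n (suc d) {i + suc e} (≤-trans (s≤s z≤n) (m≤n+m (suc e) i)))
      decide 0ℙ d-even =
        let y , y-walk = shortcut {x} i (suc d) (suc e) (subst (λ m → ClosedWalk G m x) (sym n≡) walk)
                           (trans eq (cong (x ∘ suc) (+-comm i d)))
        in shorter lt (rec lt) y
             (begin
               parity (i + suc e)                      ≡⟨ cong (ℙ._+ parity (i + suc e)) (sym d-even) ⟩
               parity (suc d) ℙ.+ parity (i + suc e)   ≡⟨ sym (+-homo-+ (suc d) (i + suc e)) ⟩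
               parity (suc d + (i + suc e))            ≡⟨ cong parity n≡ ⟩
               parity n′                               ≡⟨ odd ⟩
               1ℙ                                      ∎)
             y-walk
        where
        open ≡-Reasoning
        lt : i + suc e < n′
        lt = subst (i + suc e <_) n≡ (m<n+m (i + suc e) {suc d} (s≤s z≤n))

    go : ∀ n → (∀ {m} → m < n → Goal m) → Goal n
    go n rec x odd walk
      with any? (λ (i : Fin n) → any? λ (j : Fin n) →
             (i Fin.<? j) ×-dec (_≟ⱽ_ {G} (x (toℕ i)) (x (toℕ j))))
    ... | yes (i , j , i<j , eq) = split n (toℕ i) (toℕ j) i<j (toℕ<n j) rec x odd walk eq
    ... | no none = n , ≤-refl , injectiveClosedWalk⇒cycle odd walk inj
      where
      inj : Injective _≡_ _≡_ (λ (i : Fin n) → x (toℕ i))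
      inj {i} {j} eq with <-cmp (toℕ i) (toℕ j)
      ... | tri< i<j _ _ = contradiction (i , j , i<j , eq) none
      ... | tri≈ _ i≡j _ = toℕ-injective i≡j
      ... | tri> _ _ j<i = contradiction (j , i , j<i , sym eq) none

-- Ordering the vertices by colour classes

-- A missed value could be punched out of the codomain, which would inject `Fin (suc n)` into
-- `Fin n`.
injective⇒surjective : ∀ {n} {f : Fin n → Fin n} → Injective _≡_ _≡_ f → Surjective _≡_ _≡_ f
injective⇒surjective {zero} _ ()
injective⇒surjective {suc n} {f} inj y with any? (λ x → f x Fin.≟ y)
... | yes (x , fx≡y) = x , λ { refl → fx≡y }
... | no none = contradiction (injective⇒≤ {f = λ x → punchOut (missed x)}
                  (inj ∘ punchOut-injective (missed _) (missed _))) 1+n≰n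
  where
  missed : ∀ x → y ≢ f x
  missed x y≡fx = none (x , sym y≡fx)

module _ {n m : ℕ} (key : Fin n → Fin m) where

  below : Fin n → Subset n
  below i = tabulate λ j → does (key j Fin.<? key i)

  ∈-below⁺ : ∀ {i j} → key j Fin.< key i → j ∈ below i
  ∈-below⁺ {i} {j} lt = lookup⇒[]= j _ (trans (lookup∘tabulate _ j) (dec-true (key j Fin.<? key i) lt))

  ∈-below⁻ : ∀ {i j} → j ∈ below i → key j Fin.< key i
  ∈-below⁻ {i} {j} j∈ = <ᵇ⇒< _ _
    (subst T (sym (trans (sym (lookup∘tabulate _ j)) ([]=⇒lookup j∈))) _)

  rank : Fin n → Fin n
  -- The count stays below `n` because `i` is not in `below i`.
  rank i = fromℕ< (subst (∣ below i ∣ <_) (∣⊤∣≡n n)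
    (p⊂q⇒∣p∣<∣q∣ ((λ _ → ∈⊤) , i , ∈⊤ , λ i∈ → <-irrefl refl (∈-below⁻ {i} i∈))))

  rank-mono : ∀ {i j} → key i Fin.< key j → rank i Fin.< rank j
  rank-mono {i} {j} lt = subst₂ _<_ (sym (toℕ-fromℕ< _)) (sym (toℕ-fromℕ< _))
    (p⊂q⇒∣p∣<∣q∣ ( (λ k∈ → ∈-below⁺ {j} (<-trans (∈-below⁻ {i} k∈) lt))
                  , i , ∈-below⁺ {j} lt , λ i∈ → <-irrefl refl (∈-below⁻ {i} i∈)))

  rank-injective : Injective _≡_ _≡_ key → Injective _≡_ _≡_ rank
  rank-injective inj {i} {j} eq with <-cmp (toℕ (key i)) (toℕ (key j))
  ... | tri< lt _ _ = contradiction (cong toℕ eq) (<⇒≢ (rank-mono lt))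
  ... | tri≈ _ k≡ _ = inj (toℕ-injective k≡)
  ... | tri> _ _ gt = contradiction (cong toℕ (sym eq)) (<⇒≢ (rank-mono gt))

-- Vertices are ranked by the pair of colour and index, compared lexicographically through
-- `combine`; the index only breaks ties inside a colour class.
orderingByColour : (G : Graph) {t : ℕ} (f : Vertex G → Fin t) →
  ∃ λ (σ : CircularOrdering G) →
    ∀ {a b} → f a Fin.< f b → Bijection.to σ a Fin.< Bijection.to σ b
orderingByColour G {t} f =
  mk⤖ {to = rank key ∘ to}
    ( (λ eq → Bijection.injective (↔⇒⤖ (enumeration G)) (rank-inj eq))
    , λ y → let i , h = injective⇒surjective rank-inj y
            in from i , λ { refl → h (strictlyInverseˡ i) } ) ,
  λ {a} {b} lt → rank-mono key (combine-monoˡ-< _ _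
    (subst₂ Fin._<_ (cong f (sym (strictlyInverseʳ a))) (cong f (sym (strictlyInverseʳ b))) lt))
  where
  open Inverse (enumeration G)

  key : Fin (order G) → Fin (t * order G)
  key i = combine (f (from i)) i

  rank-inj : Injective _≡_ _≡_ (rank key)
  rank-inj = rank-injective key (combine-injectiveʳ (f (from _)) _ (f (from _)) _)

InCircularOrder-rotate : ∀ {n} {x y z : Fin n} → InCircularOrder x y z → InCircularOrder y z x
InCircularOrder-rotate (inj₁ xyz)        = inj₂ (inj₂ xyz)
InCircularOrder-rotate (inj₂ (inj₁ yzx)) = inj₁ yzx
InCircularOrder-rotate (inj₂ (inj₂ zxy)) = inj₂ (inj₁ zxy)

InCircularOrder-least : ∀ {n} {x y z : Fin n} → InCircularOrder x y z → x Fin.≤ z → y Fin.< z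
InCircularOrder-least (inj₁ (_ , y<z))          _   = y<z
InCircularOrder-least (inj₂ (inj₁ (y<z , _)))   _   = y<z
InCircularOrder-least (inj₂ (inj₂ (z<x , _)))   x≤z = contradiction x≤z (<⇒≱ z<x)

-- Monotonic cycles as closed walks through the colours in order

module _ {n : ℕ} where
  private L = suc n

  suc-% : ∀ k → suc k % L ≡ suc (k % L) % L
  suc-% k = trans (cong (λ m → suc m % L) (m≡m%n+[m/n]*n k L)) ([m+kn]%n≡m%n (suc (k % L)) (k / L) L)

  toℕ-mod : ∀ k → toℕ (k mod L) ≡ k % L
  toℕ-mod k = toℕ-fromℕ< (m%n<n k L)

  module _ (G : Graph) (c : Fin L → Vertex G) where

    -- The periodic extension of the cycle to all of `ℕ`, so that a change of starting point becomes
    -- a shift of the argument.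
    unroll : ℕ → Vertex G
    unroll k = c (k mod L)

    unroll-periodic : ∀ k → unroll (L + k) ≡ unroll k
    unroll-periodic k = cong c (toℕ-injective (trans (toℕ-mod (L + k))
      (trans (cong (_% L) (+-comm L k)) (trans ([m+n]%n≡m%n k L) (sym (toℕ-mod k))))))

    adjacent-cyclically : CyclicallyAdjacent G c → ∀ i j → toℕ j ≡ suc (toℕ i) % L → Adj G (c i) (c j)
    adjacent-cyclically (adj , last) i j j≡ with m≤n⇒m<n∨m≡n (s≤s⁻¹ (toℕ<n i))
    ... | inj₁ i<n = subst₂ (λ i j → Adj G (c i) (c j))
          (toℕ-injective (trans (toℕ-inject₁ _) (toℕ-fromℕ< i<n)))
          (toℕ-injective (trans (cong suc (toℕ-fromℕ< i<n)) (sym (trans j≡ (m<n⇒m%n≡m (s≤s i<n))))))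
          (adj (fromℕ< i<n))
    ... | inj₂ i≡n = subst₂ (λ i j → Adj G (c i) (c j))
          (toℕ-injective (trans (toℕ-fromℕ n) (sym i≡n)))
          (toℕ-injective (sym (trans j≡ (trans (cong (λ m → suc m % L) i≡n) (n%n≡0 L)))))
          last

    unroll-adj : CyclicallyAdjacent G c → ∀ k → Adj G (unroll k) (unroll (suc k))
    unroll-adj adj k = adjacent-cyclically adj _ _
      (trans (toℕ-mod (suc k)) (trans (suc-% k) (cong (λ m → suc m % L) (sym (toℕ-mod k)))))

    module _ (σ : Vertex G → Fin (order G)) (mono : IsMonotonicCycle G σ c) where

      unroll-ordered : ∀ {i j k} → i < j → j < k → k < L →
        InCircularOrder (σ (unroll i)) (σ (unroll j)) (σ (unroll k))
      unroll-ordered {i} {j} {k} i<j j<k k<L = proj₂ mono _ _ _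
        (subst₂ _<_ (sym (toℕ-small i<L)) (sym (toℕ-small j<L)) i<j)
        (subst₂ _<_ (sym (toℕ-small j<L)) (sym (toℕ-small k<L)) j<k)
        where
        j<L : j < L
        j<L = <-trans j<k k<L
        i<L : i < L
        i<L = <-trans i<j j<L
        toℕ-small : ∀ {m} → m < L → toℕ (m mod L) ≡ m
        toℕ-small {m} m<L = trans (toℕ-mod m) (m<n⇒m%n≡m m<L)

      -- Monotonicity is given only for increasing indices below `L`. Reducing the three positions
      -- modulo `L` yields such indices up to a rotation, which depends on how many of the positions
      -- have passed `L`.
      unroll-ordered-from : ∀ m k → m < L → 0 < k → suc k < L →
        InCircularOrder (σ (unroll m)) (σ (unroll (m + k))) (σ (unroll (suc (m + k))))
      unroll-ordered-from m k m<L 0<k 1+k<L with <-cmp (suc (m + k)) L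
      ... | tri< lt _ _ = unroll-ordered {k = suc (m + k)} (m<m+n m 0<k) ≤-refl lt
      -- Only the last position wraps, and it becomes 0.
      ... | tri≈ _ eq _ =
        subst (λ v → InCircularOrder (σ (unroll m)) (σ (unroll (m + k))) (σ v)) wrap
          (InCircularOrder-rotate (unroll-ordered 0<m (m<m+n m 0<k) (≤-reflexive eq)))
        where
        wrap : unroll 0 ≡ unroll (suc (m + k))
        wrap = trans (sym (unroll-periodic 0)) (cong unroll (trans (+-identityʳ L) (sym eq)))
        0<m : 0 < m
        0<m = ≰⇒> λ m≤0 → <-irrefl
          (trans (cong (λ z → suc (z + k)) (sym (n≤0⇒n≡0 m≤0))) eq) 1+k<L
      -- The last two positions wrap to `b` and `suc b`; both lie before `m` because the window is
      -- shorter than a full turn.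
      ... | tri> _ _ (s≤s gt) with b , b≡ ← m≤n⇒∃[o]m+o≡n gt =
        subst₂ (λ u v → InCircularOrder (σ (unroll m)) (σ u) (σ v))
          (trans (sym (unroll-periodic b)) (cong unroll b≡))
          (trans (sym (unroll-periodic (suc b))) (cong unroll (trans (+-suc L b) (cong suc b≡))))
          (InCircularOrder-rotate (InCircularOrder-rotate (unroll-ordered {b} ≤-refl 1+b<m m<L)))
        where
        1+b<m : suc b < m
        1+b<m = +-cancelˡ-< L _ _ (subst₂ _<_
          (trans (+-suc m k) (trans (cong suc (sym b≡)) (sym (+-suc L b)))) (+-comm m L)
          (+-monoʳ-< m 1+k<L))

-- Each step rises by at least one. Counting steps from 0 gives the lower bound, and counting the
-- steps still needed to reach `n` gives the upper bound.
strictlyIncreasing⇒identity : ∀ {n} {h : ℕ → ℕ} → (∀ {k} → k < n → h k < h (suc k)) →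
  h n ≤ n → ∀ {k} → k ≤ n → h k ≡ k
strictlyIncreasing⇒identity {n} {h} inc hn≤n k≤n = ≤-antisym (upper k≤n) (lower k≤n)
  where
  lower : ∀ {k} → k ≤ n → k ≤ h k
  lower {zero}  _   = z≤n
  lower {suc k} k<n = ≤-<-trans (lower (<⇒≤ k<n)) (inc k<n)

  gap : ∀ k d → k + d ≤ n → h k + d ≤ h (k + d)
  gap k zero    _  = ≤-reflexive (trans (+-identityʳ (h k)) (cong h (sym (+-identityʳ k))))
  gap k (suc d) le with k+d<n ← subst (_≤ n) (+-suc k d) le =
    subst₂ _≤_ (sym (+-suc (h k) d)) (cong h (sym (+-suc k d)))
      (≤-<-trans (gap k d (<⇒≤ k+d<n)) (inc k+d<n))

  upper : ∀ {k} → k ≤ n → h k ≤ k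
  upper {k} k≤n with d , refl ← m≤n⇒∃[o]m+o≡n k≤n =
    +-cancelʳ-≤ d (h k) k (≤-trans (gap k d ≤-refl) hn≤n)

-- Started at its vertex of least position, the cycle runs upwards in the ordering until it closes.
-- Hence colours never drop along it, and adjacency makes them rise strictly. With at least `t`
-- vertices and only `t` colours, every colour occurs exactly once, in order.
monotonicCycle⇒closedWalk : (G : Graph) {t : ℕ} (f : Vertex G → Fin t) → IsColouring G f →
  (σ : CircularOrdering G) →
  (∀ {a b} → f a Fin.< f b → Bijection.to σ a Fin.< Bijection.to σ b) →
  HasMonotonicCycle≥ G (Bijection.to σ) t →
  ∃ λ x → ClosedWalk G t x × (∀ k → k < t → toℕ (f (x k)) ≡ k)
monotonicCycle⇒closedWalk G f proper σ σ-mono (zero , _ , _ , (() , _) , _)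
monotonicCycle⇒closedWalk G {t} f proper σ σ-mono (suc n , t≤ℓ , c , mono@((_ , _ , cyc) , _)) =
  x , (subst (λ m → ClosedWalk G m x) ℓ≡t ((λ k _ → x-adj k) , x-closed)) ,
  λ k k<t → identity (s≤s⁻¹ (≤-trans k<t t≤ℓ))
  where
  s : Vertex G → Fin (order G)
  s = Bijection.to σ

  start : Fin (suc n)
  start = argmin (toℕ ∘ s ∘ c) zero (allFin (suc n))

  start-least : ∀ i → s (c start) Fin.≤ s (c i)
  start-least i = All.lookup (f[argmin]≤f[xs] {f = toℕ ∘ s ∘ c} zero (allFin (suc n))) (∈-allFin i)

  m : ℕ
  m = toℕ start

  x : ℕ → Vertex G
  x k = unroll G c (m + k)

  x-adj : ∀ k → Adj G (x k) (x (suc k))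
  x-adj k = subst (Adj G (x k) ∘ unroll G c) (sym (+-suc m k)) (unroll-adj G c cyc (m + k))

  x-closed : x (suc n) ≡ x 0
  x-closed = trans (cong (unroll G c) (+-comm m (suc n)))
    (trans (unroll-periodic G c m) (cong (unroll G c) (sym (+-identityʳ m))))

  m-start : unroll G c m ≡ c start
  m-start = cong c (toℕ-injective (trans (toℕ-mod m) (m<n⇒m%n≡m (toℕ<n start))))

  m-least : ∀ k → s (unroll G c m) Fin.≤ s (unroll G c k)
  m-least k = subst (λ v → s v Fin.≤ s (unroll G c k)) (sym m-start) (start-least _)

  x-increasing : ∀ {k} → k < n → s (x k) Fin.< s (x (suc k))
  -- The first step involves only two vertices, so no circular triple applies: minimality gives the
  -- weak inequality and adjacency excludes equality.
  x-increasing {zero} _ = ≤∧≢⇒<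
    (subst (λ j → s (unroll G c j) Fin.≤ s (x 1)) (sym (+-identityʳ m)) (m-least (m + 1)))
    λ eq → adj-irrefl G (Bijection.injective σ (toℕ-injective eq)) (x-adj 0)
  x-increasing {suc k} k<n = subst (λ j → s (x (suc k)) Fin.< s (unroll G c j)) (sym (+-suc m (suc k)))
    (InCircularOrder-least
      (unroll-ordered-from G c s mono m (suc k) (toℕ<n start) (s≤s z≤n) (s≤s k<n)) (m-least (suc (m + suc k))))

  colour-increasing : ∀ {k} → k < n → toℕ (f (x k)) < toℕ (f (x (suc k)))
  colour-increasing {k} k<n = ≤∧≢⇒<
    (≮⇒≥ λ lt → <-asym (σ-mono lt) (x-increasing k<n))
    λ eq → proper _ _ (x-adj k) (toℕ-injective eq)

  identity : ∀ {k} → k ≤ n → toℕ (f (x k)) ≡ k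
  -- The final colour is less than `t`, and `t` is at most `suc n`, so the final colour is at most
  -- `n`.
  identity = strictlyIncreasing⇒identity colour-increasing (s≤s⁻¹ (≤-trans (toℕ<n (f (x n))) t≤ℓ))

  ℓ≡t : suc n ≡ t
  ℓ≡t = ≤-antisym (subst (_< t) (identity ≤-refl) (toℕ<n (f (x n)))) t≤ℓ

-- Colouring Mycielskians

-- The colour of `w` is freed: a vertex `a` whose copy `aᵛ` has that colour takes the colour of `aᵘ`
-- instead, which differs from that of `w` by adjacency.
𝓜-colourable⁻ : ∀ {G} k → Colourable (𝓜 G) k → ∃ λ j → k ≡ suc j × Colourable G j
𝓜-colourable⁻ zero (f , _) with () ← f w
𝓜-colourable⁻ {G} (suc j) (f , proper) = j , refl , (λ a → punchOut (avoids a)) , λ a b ab eq →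
    clash ab (proj₂ (proj₂ (new a))) (proj₂ (proj₂ (new b))) (punchOut-injective (avoids a) (avoids b) eq)
  where
  new : ∀ a → ∃ λ q → f w ≢ q × (q ≡ f (a ᵛ) ⊎ (q ≡ f (a ᵘ) × f (a ᵛ) ≡ f w))
  new a with f (a ᵛ) Fin.≟ f w
  ... | yes eq = f (a ᵘ) , proper _ _ wu , inj₂ (refl , eq)
  ... | no neq = f (a ᵛ) , neq ∘ sym , inj₁ refl

  avoids : ∀ a → f w ≢ proj₁ (new a)
  avoids a = proj₁ (proj₂ (new a))

  clash : ∀ {a b q q′} → Adj G a b →
          q ≡ f (a ᵛ) ⊎ (q ≡ f (a ᵘ) × f (a ᵛ) ≡ f w) →
          q′ ≡ f (b ᵛ) ⊎ (q′ ≡ f (b ᵘ) × f (b ᵛ) ≡ f w) → q ≢ q′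
  clash ab (inj₁ refl)       (inj₁ refl)       = proper _ _ (vv ab)
  clash ab (inj₁ refl)       (inj₂ (refl , _)) = proper _ _ (vu ab)
  clash ab (inj₂ (refl , _)) (inj₁ refl)       = proper _ _ (uv ab)
  -- Two adjacent vertices cannot both be recoloured, since their `ᵛ` copies would share the colour
  -- of `w`.
  clash ab (inj₂ (_ , p))    (inj₂ (_ , q))    = contradiction (trans p (sym q)) (proper _ _ (vv ab))

𝓜^-colourable⁻ : ∀ {G} r {t} → Colourable (𝓜^ r G) t → ∃ λ s → t ≡ r + s × Colourable G s
𝓜^-colourable⁻ zero    {t} col = t , refl , col
𝓜^-colourable⁻ {G} (suc r) {t} col =
  let j , t≡1+j , col-j = 𝓜-colourable⁻ {𝓜^ r G} t col
      s , j≡r+s , col-s = 𝓜^-colourable⁻ r col-j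
  in s , trans t≡1+j (cong suc j≡r+s) , col-s

hasEdge⇒2≤colours : ∀ {G s} → HasEdge G → Colourable G s → 2 ≤ s
hasEdge⇒2≤colours {s = zero}        (a , _)      (f , _)      with () ← f a
hasEdge⇒2≤colours {s = suc zero}    (a , b , ab) (f , proper) = contradiction (lemma (f a) (f b)) (proper a b ab)
  where
  lemma : ∀ (i j : Fin 1) → i ≡ j
  lemma zero zero = refl
hasEdge⇒2≤colours {s = suc (suc s)} _            _            = s≤s (s≤s z≤n)

freshen : ℕ → ℕ → ℕ
freshen n zero          = n
freshen n (suc zero)    = n
freshen n (suc (suc k)) = suc (suc k)

freshen-cases : ∀ n k → (k < 2 × freshen n k ≡ n) ⊎ (2 ≤ k × freshen n k ≡ k)
freshen-cases n zero          = inj₁ (s≤s z≤n , refl)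
freshen-cases n (suc zero)    = inj₁ (s≤s (s≤s z≤n) , refl)
freshen-cases n (suc (suc k)) = inj₂ (s≤s (s≤s z≤n) , refl)

-- Later lemmas take `n` to be a strict bound on the values of `f`, so that `n` itself is the new
-- colour.
extend : {V : Set} → ℕ → (V → ℕ) → MycielskiVertex V → ℕ
extend n f w     = 1
extend n f (a ᵘ) = freshen n (f a)
extend n f (a ᵛ) = f a

module _ (G : Graph) {n : ℕ} (2≤n : 2 ≤ n) {f : Vertex G → ℕ} (f<n : ∀ a → f a < n) where

  2≤freshen : ∀ a → 2 ≤ freshen n (f a)
  2≤freshen a with freshen-cases n (f a)
  ... | inj₁ (_ , eq)   = subst (2 ≤_) (sym eq) 2≤n
  ... | inj₂ (2≤k , eq) = subst (2 ≤_) (sym eq) 2≤k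

  extend-bounded : ∀ a → extend n f a < suc n
  extend-bounded w     = s≤s (<⇒≤ 2≤n)
  extend-bounded (a ᵛ) = m≤n⇒m≤1+n (f<n a)
  extend-bounded (a ᵘ) with freshen-cases n (f a)
  ... | inj₁ (_ , eq) = s≤s (≤-reflexive eq)
  ... | inj₂ (_ , eq) = subst (_< suc n) (sym eq) (m≤n⇒m≤1+n (f<n a))

  extend-proper : (∀ a b → Adj G a b → f a ≢ f b) →
                  ∀ a b → Adj (𝓜 G) a b → extend n f a ≢ extend n f b
  extend-proper proper = go
    where
    fresh : ∀ {a b} → Adj G a b → freshen n (f a) ≢ f b
    fresh {a} {b} ab eq with freshen-cases n (f a)
    ... | inj₁ (_ , eq′) = <⇒≢ (f<n b) (trans (sym eq) eq′)
    ... | inj₂ (_ , eq′) = proper _ _ ab (trans (sym eq′) eq)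

    go : ∀ a b → Adj (𝓜 G) a b → extend n f a ≢ extend n f b
    go _ _ (vv ab)    = proper _ _ ab
    go _ _ (uv ab)    = fresh ab
    go _ _ (vu ab)    = fresh (adj-sym G ab) ∘ sym
    go _ _ (wu {a})   = <⇒≢ (2≤freshen a)
    go _ _ (uw {a})   = <⇒≢ (2≤freshen a) ∘ sym

  w-neighbour : ∀ {b} → Adj (𝓜 G) w b → 2 ≤ extend n f b
  w-neighbour (wu {a}) = 2≤freshen a

-- Projecting a closed walk down one Mycielskian

-- Positions p ≥ n carried one of the colours n, n + 1, … before the projection.
Pattern : {V : Set} → ℕ → (V → ℕ) → ℕ → (ℕ → V) → Set
Pattern n f t x = ∀ p → p ≤ t → (p < n → f (x p) ≡ p) × (n ≤ p → f (x p) < 2)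

-- The value at `w` is a placeholder: the projected walks avoid `w`.
project : {V : Set} → V → MycielskiVertex V → V
project v w     = v
project v (a ᵘ) = a
project v (a ᵛ) = a

project-adj : (G : Graph) (v : Vertex G) {a b : Vertex (𝓜 G)} → a ≢ w → b ≢ w →
              Adj (𝓜 G) a b → Adj G (project v a) (project v b)
project-adj G v a≢w b≢w (vv ab) = ab
project-adj G v a≢w b≢w (uv ab) = ab
project-adj G v a≢w b≢w (vu ab) = ab
project-adj G v a≢w b≢w wu      = contradiction refl a≢w
project-adj G v a≢w b≢w uw      = contradiction refl b≢w

module _ (G : Graph) (v : Vertex G) {n t : ℕ} (2≤n : 2 ≤ n) (n<t : n < t)
         {f : Vertex G → ℕ} (f<n : ∀ a → f a < n)
         {x : ℕ → Vertex (𝓜 G)} (walk : ClosedWalk (𝓜 G) t x)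
         (pattern-x : Pattern (suc n) (extend n f) t x) where

  private
    adj = proj₁ walk

    small-neighbour⇒≢w : ∀ {a b} → Adj (𝓜 G) a b → extend n f b < 2 → a ≢ w
    small-neighbour⇒≢w ab small refl = <⇒≱ small (w-neighbour G 2≤n f<n ab)

    colour-0 : extend n f (x 0) ≡ 0
    colour-0 = proj₁ (pattern-x 0 z≤n) (s≤s z≤n)

  -- Since `w` has colour 1, among the positions that kept their colour only position 1 could be
  -- `w`, but its predecessor has colour 0. Any later position has a successor of colour at most 1,
  -- or is the closing one, equal to `x 0`.
  avoids-w : ∀ p → p ≤ t → x p ≢ w
  avoids-w p p≤t x≡w with p <? suc n
  avoids-w (suc zero) p≤t x≡w | yes _ =
    small-neighbour⇒≢w (adj-sym (𝓜 G) (adj 0 p≤t)) (subst (_< 2) (sym colour-0) (s≤s z≤n)) x≡w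
  avoids-w zero p≤t x≡w | yes p≤n
    with () ← trans (sym colour-0) (cong (extend n f) x≡w)
  avoids-w (suc (suc p)) p≤t x≡w | yes p≤n
    with () ← trans (sym (proj₁ (pattern-x (suc (suc p)) p≤t) p≤n)) (cong (extend n f) x≡w)
  avoids-w p p≤t x≡w | no p≰n with m≤n⇒m<n∨m≡n p≤t
  ... | inj₁ p<t = small-neighbour⇒≢w (adj p p<t)
                     (proj₂ (pattern-x (suc p) p<t) (m≤n⇒m≤1+n (≮⇒≥ p≰n))) x≡w
  ... | inj₂ refl with () ← trans (sym colour-0) (cong (extend n f) (trans (sym (proj₂ walk)) x≡w))

  project-walk : ClosedWalk G t (project v ∘ x)
  project-walk =
    (λ k k<t → project-adj G v (avoids-w k (<⇒≤ k<t)) (avoids-w (suc k) k<t) (adj k k<t)) ,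
    cong (project v) (proj₂ walk)

  -- Position `n` carries the new colour, so it is some `aᵘ` whose base vertex has colour 0 or 1.
  -- Positions beyond it already had a colour below 2, so each is some `aᵛ` and keeps it. Positions
  -- before `n` keep their own colour.
  project-pattern : Pattern n f t (project v ∘ x)
  project-pattern p p≤t with x p | avoids-w p p≤t | pattern-x p p≤t
  ... | w   | ≢w | _       = contradiction refl ≢w
  ... | a ᵛ | _  | lo , hi = (lo ∘ m≤n⇒m≤1+n) , λ n≤p → hi (≤∧≢⇒< n≤p λ { refl → <⇒≢ (f<n a) (lo ≤-refl) })
  ... | a ᵘ | _  | lo , hi with freshen-cases n (f a)
  ...   | inj₁ (small , eq) = (λ p<n → contradiction (trans (sym (lo (m≤n⇒m≤1+n p<n))) eq) (<⇒≢ p<n)) , λ _ → small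
  ...   | inj₂ (_ , eq) = (λ p<n → trans (sym eq) (lo (m≤n⇒m≤1+n p<n))) ,
                          λ n≤p → ⊥-elim (big n≤p)
    where
    -- Beyond `n`, no `aᵘ` has a colour below 2; at `n` itself, an unchanged colour would violate
    -- the bound on `f`.
    big : ¬ n ≤ p
    big n≤p with m≤n⇒m<n∨m≡n n≤p
    ... | inj₁ n<p  = <⇒≱ (hi n<p) (2≤freshen G 2≤n f<n a)
    ... | inj₂ refl = <⇒≢ (f<n a) (trans (sym eq) (lo ≤-refl))

-- The colouring and ordering of the iterated Mycielskian

module _ (G : Graph) (e : HasEdge G) {s : ℕ} (2≤s : 2 ≤ s)
         (g : Vertex G → ℕ) (g<s : ∀ a → g a < s) (g-proper : ∀ a b → Adj G a b → g a ≢ g b) where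

  2≤+s : ∀ i → 2 ≤ i + s
  2≤+s i = ≤-trans 2≤s (m≤n+m s i)

  colour : ∀ i → Vertex (𝓜^ i G) → ℕ
  colour zero    = g
  colour (suc i) = extend (i + s) (colour i)

  colour-bounded : ∀ i a → colour i a < i + s
  colour-bounded zero    = g<s
  colour-bounded (suc i) = extend-bounded (𝓜^ i G) (2≤+s i) (colour-bounded i)

  colour-proper : ∀ i a b → Adj (𝓜^ i G) a b → colour i a ≢ colour i b
  colour-proper zero    = g-proper
  colour-proper (suc i) = extend-proper (𝓜^ i G) (2≤+s i) (colour-bounded i) (colour-proper i)

  descend : ∀ i {t x} → i + s ≤ t → ClosedWalk (𝓜^ i G) t x → Pattern (i + s) (colour i) t x →
            ∃ (ClosedWalk G t)
  -- The pattern serves only to keep the walk off `w` during the descent; at `G` the walk alone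
  -- matters.
  descend zero    _    walk _   = _ , walk
  descend (suc i) i<t walk pat = descend i (<⇒≤ i<t)
    (project-walk H v (2≤+s i) i<t (colour-bounded i) walk pat)
    (project-pattern H v (2≤+s i) i<t (colour-bounded i) walk pat)
    where
    H = 𝓜^ i G
    v : Vertex H
    v = proj₁ (𝓜^-hasEdge i e)

  colourᶠ : ∀ r → Vertex (𝓜^ r G) → Fin (r + s)
  colourᶠ r a = fromℕ< (colour-bounded r a)

  toℕ-colourᶠ : ∀ r a → toℕ (colourᶠ r a) ≡ colour r a
  toℕ-colourᶠ r a = toℕ-fromℕ< (colour-bounded r a)

  colourᶠ-proper : ∀ r → IsColouring (𝓜^ r G) (colourᶠ r)
  colourᶠ-proper r a b ab eq = colour-proper r a b ab
    (trans (sym (toℕ-colourᶠ r a)) (trans (cong toℕ eq) (toℕ-colourᶠ r b)))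

  σ : ∀ r → CircularOrdering (𝓜^ r G)
  σ r = proj₁ (orderingByColour (𝓜^ r G) (colourᶠ r))

  monotonicCycle⇒closedWalkBelow : ∀ r →
    HasMonotonicCycle≥ (𝓜^ r G) (Bijection.to (σ r)) (r + s) → ∃ (ClosedWalk G (r + s))
  monotonicCycle⇒closedWalkBelow r cycle
    with x , walk , rainbow ← monotonicCycle⇒closedWalk (𝓜^ r G) (colourᶠ r) (colourᶠ-proper r)
                                (σ r) (proj₂ (orderingByColour (𝓜^ r G) (colourᶠ r))) cycle
    = descend r ≤-refl walk pat
    where
    0<t : 0 < r + s
    0<t = <⇒≤ (2≤+s r)

    pat : Pattern (r + s) (colour r) (r + s) x
    pat p p≤t =
      (λ p<t → trans (sym (toℕ-colourᶠ r (x p))) (rainbow p p<t)) ,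
      -- At the top level the only position not below the bound is the closing one, `p = t`, which
      -- is `x 0` of colour 0.
      λ t≤p → subst (_< 2)
        (sym (trans (cong (colour r ∘ x) (≤-antisym p≤t t≤p))
             (trans (cong (colour r) (proj₂ walk))
             (trans (sym (toℕ-colourᶠ r (x 0))) (rainbow 0 0<t)))))
        (s≤s z≤n)

-- Comparison with the odd girth

<oddGirth⇒no-oddCycle : ∀ {G t} → [ t ] <⁺ oddGirth G → ∀ {ℓ} → ℓ ≤ t → ¬ HasOddCycle G ℓ
<oddGirth⇒no-oddCycle {G} {t} t<g {ℓ} ℓ≤t cycle = go (oddGirth G) (proj₂ (oddGirthOf G)) t<g
  where
  -- The odd girth is abstract, so it is generalised to a variable before the finite and infinite
  -- cases are separated.
  go : ∀ g → IsOddGirth G g → ¬ [ t ] <⁺ g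
  go _ none      [ _ ]<⊤⁺ = none ℓ cycle
  go _ (_ , least) [ t<g ]  = <⇒≱ t<g (≤-trans (least ℓ cycle) ℓ≤t)

theorem1p1 : (G : Graph) (e : HasEdge G) (r : ℕ) →
    let t = χ (𝓜^ r G) in
    Odd t → [ t ] <⁺ oddGirth G → α° (𝓜^ r G) (𝓜^-hasEdge r e) < t
theorem1p1 G e r odd t<girth =
  let t = χ (𝓜^ r G)
      s , t≡r+s , g , g-proper = 𝓜^-colourable⁻ {G} r (proj₁ (proj₂ (chromaticNumber (𝓜^ r G))))
      2≤s = hasEdge⇒2≤colours {G} e (g , g-proper)
      g-proper′ = λ a b ab → g-proper a b ab ∘ toℕ-injective
      ordering = σ G e 2≤s (toℕ ∘ g) (toℕ<n ∘ g) g-proper′ r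
  -- If the altitude were at least `t`, the ordering by colour classes would contain a monotonic
  -- cycle of length at least `t`.
  in ≰⇒> λ t≤α →
    let m , α≤m , cycle = proj₁ (proj₂ (circularAltitude (𝓜^ r G) (𝓜^-hasEdge r e))) ordering
        x , walk = monotonicCycle⇒closedWalkBelow G e 2≤s (toℕ ∘ g) (toℕ<n ∘ g) g-proper′ r
                     (m , subst (_≤ m) t≡r+s (≤-trans t≤α α≤m) , cycle)
        ℓ , ℓ≤t , oddCycle = oddClosedWalk⇒oddCycle G t x odd
                               (subst (λ k → ClosedWalk G k x) (sym t≡r+s) walk)
    in <oddGirth⇒no-oddCycle {G} t<girth ℓ≤t oddCycle
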